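{- There is no cubefree word $x$ over the binary alphabet $\{0,1\}$ of (finite) length greater than $17$ whose curling-number transform $C(x)$ is also cubefree.
   Context: Words are indexed from $0$: a finite word of length $n$ is $x = x[0]x[1]\cdots x[n-1]$, and $x[i..j]$ denotes the factor (contiguous block) $x[i]\cdots x[j]$. A finite or infinite word is cubefree if it contains no factor of the form $yyy$ with $y$ a nonempty word. The curling number of a nonempty finite word $u$ is the largest integer $k \ge 1$ such that $u = y z^k$ for some (possibly empty) word $y$ and some nonempty word $z$. For a finite or infinite word $x$, the curling-number transform $C(x)$ is the word over the positive integers, of the same length as $x$, whose $i$-th letter $C(x)[i]$ is the curling number of the prefix $x[0..i]$. -}

module Defs where

open import Data.Fin using (Fin; toℕ; fromℕ<)
open import Data.Fin.Properties using (any?; toℕ-fromℕ<)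
open import Data.List using (List; []; _∷_; _++_; concat; drop; length; replicate; tabulate; take)
open import Data.List.Properties using (++-assoc; ++-identityʳ; length-++; length-++-≤ˡ; length-++-≤ʳ; ≡-dec)
open import Data.Nat using (ℕ; zero; suc; _≤_; _*_; s≤s; s≤s⁻¹)
open import Data.Nat.Properties using (≤-trans; ≤-reflexive; m≤n⇒m<n∨m≡n; m≤m*n)
open import Data.Product using (∃; ∃-syntax; _×_; _,_)
open import Data.Sum using (inj₁; inj₂)
open import Level using (Level)
open import Relation.Binary.Definitions using (DecidableEquality)
open import Relation.Binary.PropositionalEquality using (_≡_; _≢_; refl; sym; trans; cong; cong₂; subst)
open import Relation.Nullary using (Dec; yes; no; ¬_; ¬?; contradiction)
open import Relation.Nullary.Decidable using (map′; _×-dec_)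

private
  variable
    a : Level
    A : Set a

Word : Set a → Set a
Word = List

infixr 8 _^ʷ_

_^ʷ_ : Word A → ℕ → Word A
z ^ʷ k = concat (replicate k z)

_IsFactorOf_ : Word A → Word A → Set _
w IsFactorOf x = ∃[ p ] ∃[ s ] x ≡ p ++ w ++ s

Cubefree : Word A → Set _
Cubefree x = ∀ y → y ≢ [] → ¬ ((y ++ y ++ y) IsFactorOf x)

EndsInPower : Word A → ℕ → Set _
EndsInPower u k = ∃[ y ] ∃[ z ] (z ≢ [] × u ≡ y ++ z ^ʷ k)

record IsCurlingNumber {A : Set a} (u : Word A) (k : ℕ) : Set a where
  field
    positive : 1 ≤ k
    attained : EndsInPower u k
    maximal  : ∀ j → EndsInPower u j → j ≤ k

private
  take-length : ∀ (y w : Word A) → take (length y) (y ++ w) ≡ y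
  take-length []      w = refl
  take-length (c ∷ y) w = cong (c ∷_) (take-length y w)

  drop-length : ∀ (y w : Word A) → drop (length y) (y ++ w) ≡ w
  drop-length []      w = refl
  drop-length (_ ∷ y) w = drop-length y w

  length-^ʷ : ∀ (z : Word A) k → length (z ^ʷ k) ≡ k * length z
  length-^ʷ z zero    = refl
  length-^ʷ z (suc k) rewrite length-++ z {z ^ʷ k} | length-^ʷ z k = refl

  power-bound : ∀ {u : Word A} j → EndsInPower u j → j ≤ length u
  power-bound j (y , []         , z≢[] , _)    = contradiction refl z≢[]
  power-bound j (y , z@(_ ∷ z′) , _    , refl) =
    ≤-trans (m≤m*n j (length z))
      (≤-trans (≤-reflexive (sym (length-^ʷ z j))) (length-++-≤ʳ (z ^ʷ j) {y}))

module Curling {A : Set a} (_≟_ : DecidableEquality A) where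

  private
    _≟ʷ_ : DecidableEquality (Word A)
    _≟ʷ_ = ≡-dec _≟_

    -- y and z are the blocks of u of lengths i and l, starting at 0 and i.
    SplitsAt : Word A → ℕ → ℕ → ℕ → Set a
    SplitsAt u k i l =
      take l (drop i u) ≢ [] × u ≡ take i u ++ take l (drop i u) ^ʷ k

    Split : Word A → ℕ → Set a
    Split u k = ∃ λ (i : Fin (suc (length u))) → ∃ λ (l : Fin (suc (length u))) →
                SplitsAt u k (toℕ i) (toℕ l)

    split⇒power : ∀ u k → Split u k → EndsInPower u k
    split⇒power u k (i , l , z≢[] , eq) = _ , _ , z≢[] , eq

    power⇒split : ∀ u k → EndsInPower u (suc k) → Split u (suc k)
    power⇒split u k (y , z , z≢[] , refl) =
      fromℕ< (s≤s y≤) , fromℕ< (s≤s z≤) ,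
      subst (λ i → SplitsAt u (suc k) i (toℕ (fromℕ< (s≤s z≤)))) (sym (toℕ-fromℕ< (s≤s y≤)))
        (subst (SplitsAt u (suc k) (length y)) (sym (toℕ-fromℕ< (s≤s z≤)))
          ( (λ e → z≢[] (trans (sym z≡) e))
          , sym (cong₂ _++_ (take-length y w) (cong (_^ʷ suc k) z≡))))
      where
      w : Word A
      w = z ^ʷ suc k

      y≤ : length y ≤ length u
      y≤ = length-++-≤ˡ y

      z≤ : length z ≤ length u
      z≤ = ≤-trans (length-++-≤ˡ z) (length-++-≤ʳ w {y})

      z≡ : take (length z) (drop (length y) u) ≡ z
      z≡ = trans (cong (take (length z)) (drop-length y w)) (take-length z (z ^ʷ k))

  endsInPower? : ∀ u k → Dec (EndsInPower u (suc k))
  endsInPower? u k =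
    map′ (split⇒power u (suc k)) (power⇒split u k)
      (any? λ i → any? λ l →
        ¬? (take (toℕ l) (drop (toℕ i) u) ≟ʷ [])
          ×-dec (u ≟ʷ (take (toℕ i) u ++ take (toℕ l) (drop (toℕ i) u) ^ʷ suc k)))

  largestPower : Word A → ℕ → ℕ
  largestPower u zero    = zero
  largestPower u (suc n) with endsInPower? u n
  ... | yes _ = suc n
  ... | no  _ = largestPower u n

  -- An exponent never exceeds the length of the word, so the search is
  -- exhaustive.  The empty word, which has no curling number, gets the value 0.
  curlingNumber : Word A → ℕ
  curlingNumber u = largestPower u (length u)

  private
    largestPower-maximal : ∀ u n j → j ≤ n → EndsInPower u j → j ≤ largestPower u n
    largestPower-maximal u zero    j j≤n p = j≤n
    largestPower-maximal u (suc n) j j≤n p with endsInPower? u n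
    ... | yes _ = j≤n
    ... | no ¬p with m≤n⇒m<n∨m≡n j≤n
    ...   | inj₁ j<1+n = largestPower-maximal u n j (s≤s⁻¹ j<1+n) p
    ...   | inj₂ refl  = contradiction p ¬p

    largestPower-attained : ∀ u n → u ≢ [] → EndsInPower u (largestPower u n)
    largestPower-attained u zero    u≢[] = u , u , u≢[] , sym (++-identityʳ u)
    largestPower-attained u (suc n) u≢[] with endsInPower? u n
    ... | yes p = p
    ... | no  _ = largestPower-attained u n u≢[]

  curlingNumber-correct : ∀ u → u ≢ [] → IsCurlingNumber u (curlingNumber u)
  curlingNumber-correct u u≢[] = record
    { positive = maximal 1 ([] , u , u≢[] , sym (++-identityʳ u))
    ; attained = largestPower-attained u (length u) u≢[]
    ; maximal  = maximal
    }
    where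
    maximal : ∀ j → EndsInPower u j → j ≤ curlingNumber u
    maximal j p = largestPower-maximal u (length u) j (power-bound j p) p

  C : Word A → Word ℕ
  C x = tabulate {n = length x} λ i → curlingNumber (take (suc (toℕ i)) x)

{-# OPTIONS --safe #-}
-- Both conditions pass to prefixes, so it suffices that the tree of binary words x with x and C(x)
-- cubefree has no node at depth 18.  The tree is small enough (403 nodes, including the dead leaves)
-- to be traversed by evaluation during type checking.  Below a cubefree prefix the next letter of C(x)
-- is 2 or 1, according to whether the extended prefix ends in a square.
module Submission where

open import Defs
open import Data.Fin using (Fin; _≟_; toℕ; zero; suc)
open import Data.List using (length; []; _∷_; [_]; _++_; _∷ʳ_; tabulate; take)
open import Data.List.Properties
  using (++-assoc; ++-conicalˡ; ++-conicalʳ; ++-identityʳ; length-++; ∷ʳ-++; ≡-dec)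
open import Data.Maybe using (Maybe; just; nothing; from-just; zipWith)
import Data.Nat as ℕ
open import Data.Nat using (ℕ; zero; suc; _+_; _*_; _/_; _≤_; _>_; z≤n; s≤s; _≤′_; ≤′-refl; ≤′-step)
open import Data.Nat.DivMod using (m*n/n≡m)
open import Data.Nat.Properties using (*-comm; ≤-antisym; ≮⇒≥; ≤⇒≤′)
open import Data.Product using (Σ-syntax; ∃-syntax; _×_; _,_)
open import Data.Sum using (_⊎_; inj₁; inj₂; [_,_]′)
open import Function using (_∘_)
open import Level using (Level)
open import Relation.Binary.Definitions using (DecidableEquality)
open import Relation.Binary.PropositionalEquality
  using (_≡_; _≢_; refl; sym; trans; cong; subst; module ≡-Reasoning)
open import Relation.Nullary using (Dec; yes; no; ¬_; ¬?)
open import Relation.Nullary.Decidable using (map′; _×-dec_; _⊎-dec_)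

private
  variable
    a b : Level
    A : Set a
    B : Set b

length-^ʷ : ∀ (z : Word A) k → length (z ^ʷ k) ≡ k * length z
length-^ʷ z zero    = refl
length-^ʷ z (suc k) = trans (length-++ z) (cong (length z +_) (length-^ʷ z k))

take-length-++ : ∀ (y w : Word A) → take (length y) (y ++ w) ≡ y
take-length-++ []      w = refl
take-length-++ (c ∷ y) w = cong (c ∷_) (take-length-++ y w)

-- `C` is definitionally `prefixMap curlingNumber`. With the function abstract, the induction in
-- `prefixMap-++` can absorb the letters of `x` into it.
prefixMap : (Word A → B) → Word A → Word B
prefixMap g x = tabulate {n = length x} λ i → g (take (suc (toℕ i)) x)

prefixMap-++ : ∀ (g : Word A → B) x y →
               prefixMap g (x ++ y) ≡ prefixMap g x ++ prefixMap (g ∘ (x ++_)) y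
prefixMap-++ g []      y = refl
prefixMap-++ g (c ∷ x) y = cong (g [ c ] ∷_) (prefixMap-++ (g ∘ (c ∷_)) x y)

EndsInPower-suc : ∀ {u : Word A} k → EndsInPower u (suc k) → EndsInPower u k
EndsInPower-suc k (y , z , z≢[] , u≡) =
  y ++ z , z , z≢[] , trans u≡ (sym (++-assoc y z (z ^ʷ k)))

EndsInPower-≤′ : ∀ {u : Word A} {m n} → m ≤′ n → EndsInPower u n → EndsInPower u m
EndsInPower-≤′ ≤′-refl               p = p
EndsInPower-≤′ (≤′-step {n = n} m≤n) p = EndsInPower-≤′ m≤n (EndsInPower-suc n p)

endsInPower-1 : ∀ {u : Word A} → u ≢ [] → EndsInPower u 1
endsInPower-1 {u = u} u≢[] = [] , u , u≢[] , sym (++-identityʳ u)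

-- The exponents of suffix powers are downward closed, so failure at one exponent excludes all
-- larger ones.
isCurlingNumber : ∀ {u : Word A} k → EndsInPower u (suc k) → ¬ EndsInPower u (suc (suc k)) →
                  IsCurlingNumber u (suc k)
isCurlingNumber k p ¬p = record
  { positive = s≤s z≤n
  ; attained = p
  ; maximal  = λ j q → ≮⇒≥ λ k<j → ¬p (EndsInPower-≤′ (≤⇒≤′ k<j) q)
  }

IsCurlingNumber-unique : ∀ {u : Word A} {m n} →
                         IsCurlingNumber u m → IsCurlingNumber u n → m ≡ n
IsCurlingNumber-unique p q =
  ≤-antisym (Q.maximal _ P.attained) (P.maximal _ Q.attained)
  where
  module P = IsCurlingNumber p
  module Q = IsCurlingNumber q

cubeSuffix⇒¬cubefree : ∀ {u : Word A} → EndsInPower u 3 → ∀ s → ¬ Cubefree (u ++ s)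
cubeSuffix⇒¬cubefree (y , z , z≢[] , refl) s cubefree = cubefree z z≢[] (y , s , eq)
  where
  eq : (y ++ z ^ʷ 3) ++ s ≡ y ++ (z ++ z ++ z) ++ s
  eq = trans (++-assoc y (z ^ʷ 3) s)
             (cong (λ t → y ++ (z ++ z ++ t) ++ s) (++-identityʳ z))

-- Curling.endsInPower? searches all pairs of positions, which is too slow for the traversal.  Here
-- only the start of the power is searched: it determines the length of the root.
module PowerSuffix {A : Set a} (_≟ᴬ_ : DecidableEquality A) where

  IsPower : Word A → ℕ → Set a
  IsPower w k = ∃[ z ] (z ≢ [] × w ≡ z ^ʷ k)

  root : Word A → ℕ → Word A
  root w k = take (length w / suc k) w

  root-^ʷ : ∀ z k → root (z ^ʷ suc k) k ≡ z
  root-^ʷ z k = trans (cong (λ l → take l (z ^ʷ suc k)) quotient) (take-length-++ z (z ^ʷ k))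
    where
    open ≡-Reasoning
    quotient : length (z ^ʷ suc k) / suc k ≡ length z
    quotient = begin
      length (z ^ʷ suc k) / suc k ≡⟨ cong (_/ suc k) (length-^ʷ z (suc k)) ⟩
      suc k * length z / suc k    ≡⟨ cong (_/ suc k) (*-comm (suc k) (length z)) ⟩
      length z * suc k / suc k    ≡⟨ m*n/n≡m (length z) (suc k) ⟩
      length z                    ∎

  -- Rounding down in `root` is harmless: when `suc k` does not divide the length of `w`, the
  -- comparison with `w` fails.
  isPower? : ∀ w k → Dec (IsPower w (suc k))
  isPower? w k =
    map′ (root w k ,_) rooted
      (¬? (root w k ≟ʷ []) ×-dec (w ≟ʷ (root w k ^ʷ suc k)))
    where
    _≟ʷ_ = ≡-dec _≟ᴬ_

    rooted : IsPower w (suc k) → root w k ≢ [] × w ≡ root w k ^ʷ suc k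
    rooted (z , z≢[] , refl) =
      subst (λ r → r ≢ [] × w ≡ r ^ʷ suc k) (sym (root-^ʷ z k)) (z≢[] , refl)

  endsInPower? : ∀ u k → Dec (EndsInPower u (suc k))
  endsInPower? []      k =
    no λ (y , z , z≢[] , eq) → z≢[] (++-conicalˡ z _ (++-conicalʳ y _ (sym eq)))
  endsInPower? (c ∷ u) k = map′ to from (isPower? (c ∷ u) k ⊎-dec endsInPower? u k)
    where
    to : IsPower (c ∷ u) (suc k) ⊎ EndsInPower u (suc k) → EndsInPower (c ∷ u) (suc k)
    to = [ [] ,_ , (λ (y , z , z≢[] , eq) → c ∷ y , z , z≢[] , cong (c ∷_) eq) ]′

    from : EndsInPower (c ∷ u) (suc k) → IsPower (c ∷ u) (suc k) ⊎ EndsInPower u (suc k)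
    from ([]    , z , z≢[] , eq)   = inj₁ (z , z≢[] , eq)
    from (_ ∷ y , z , z≢[] , refl) = inj₂ (y , z , z≢[] , refl)

module Letters   = PowerSuffix {A = Fin 2} _≟_
module Exponents = PowerSuffix ℕ._≟_
open Curling {A = Fin 2} _≟_ using (C; curlingNumber; curlingNumber-correct)

∷ʳ-≢[] : ∀ (x : Word A) c → x ∷ʳ c ≢ []
∷ʳ-≢[] x c eq with () ← ++-conicalʳ x [ c ] eq

-- Uniqueness replaces the computed last letter by any certified value, so the traversal never
-- evaluates the slow `curlingNumber`.
C-∷ʳ : ∀ x c {k} → IsCurlingNumber (x ∷ʳ c) k → C (x ∷ʳ c) ≡ C x ∷ʳ k
C-∷ʳ x c isC =
  trans (prefixMap-++ curlingNumber x [ c ])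
        (cong (λ k → C x ∷ʳ k)
              (IsCurlingNumber-unique (curlingNumber-correct _ (∷ʳ-≢[] x c)) isC))

-- A lower bound on the length of the extension, instead of an equality, treats all longer words at
-- once.
Refuted : ℕ → Word (Fin 2) → Set
Refuted n x = ∀ y → n ≤ length y → ¬ (Cubefree (x ++ y) × Cubefree (C (x ++ y)))

refuted-branch : ∀ n x → (∀ c → Refuted n (x ∷ʳ c)) → Refuted (suc n) x
refuted-branch n x r (c ∷ y) (s≤s n≤∣y∣) =
  subst (λ w → ¬ (Cubefree w × Cubefree (C w))) (∷ʳ-++ x c y) (r c y n≤∣y∣)

refuted-cube : ∀ n x → EndsInPower x 3 → Refuted n x
refuted-cube n x cube y _ (cubefree , _) = cubeSuffix⇒¬cubefree cube y cubefree

-- `C x` is a prefix of `C (x ++ y)`, so its cube survives every extension.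
refuted-cubeC : ∀ n x → EndsInPower (C x) 3 → Refuted n x
refuted-cubeC n x cube y _ (_ , cubefree) =
  cubeSuffix⇒¬cubefree cube _ (subst Cubefree (prefixMap-++ curlingNumber x y) cubefree)

-- The word e carries C x in evaluated form along the traversal.
mutual
  refute : ∀ n x e → C x ≡ e → Maybe (Refuted n x)
  -- The argument `2` stands for exponent 3. Earlier prefixes of `e` were tested on the way down, so
  -- a new cube can only end at the last letter.
  refute n x e C≡e with Exponents.endsInPower? e 2
  refute n       x e C≡e | yes cube =
    just (refuted-cubeC n x (subst (λ w → EndsInPower w 3) (sym C≡e) cube))
  -- A surviving word of full depth would make the whole result `nothing`.
  refute zero    x e C≡e | no _ = nothing
  refute (suc n) x e C≡e | no _ =
    zipWith (λ r₀ r₁ → refuted-branch n x λ { zero → r₀ ; (suc zero) → r₁ })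
      (refuteChild n x e C≡e zero) (refuteChild n x e C≡e (suc zero))

  refuteChild : ∀ n x e → C x ≡ e → ∀ c → Maybe (Refuted n (x ∷ʳ c))
  refuteChild n x e C≡e c with Letters.endsInPower? (x ∷ʳ c) 2
  ... | yes cube = just (refuted-cube n _ cube)
  ... | no ¬cube with Letters.endsInPower? (x ∷ʳ c) 1
  ...   | yes square = refute n (x ∷ʳ c) (e ∷ʳ 2)
            (trans (C-∷ʳ x c (isCurlingNumber 1 square ¬cube)) (cong (_∷ʳ 2) C≡e))
  ...   | no ¬square = refute n (x ∷ʳ c) (e ∷ʳ 1)
            (trans (C-∷ʳ x c (isCurlingNumber 0 (endsInPower-1 (∷ʳ-≢[] x c)) ¬square))
                   (cong (_∷ʳ 1) C≡e))

theorem2 : ¬ (Σ[ x ∈ Word (Fin 2) ] (length x > 17 × Cubefree x × Cubefree (Curling.C _≟_ x)))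
-- `17 < length x` unfolds to `18 ≤ length x`, hence the depth 18. Typing `from-just` forces the
-- traversal to evaluate to a `just`.
theorem2 (x , 17<∣x∣ , cubefree) = from-just (refute 18 [] [] refl) x 17<∣x∣ cubefree
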